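{- Let $\varphi_2:\mathbb{N}\to\mathbb{N}$ be the function defined as follows. The values $\varphi_2(0),\varphi_2(1),\dots,\varphi_2(29)$ are, in order, $$1,0,2,4,3,6,5,7,8,9,\ 10,11,12,13,18,19,20,21,14,15,\ 16,17,26,27,28,29,22,23,24,25.$$ (1) If either $30\le x<56$ or $7\cdot 2^{2n}\le x<7\cdot 2^{2n+1}$ for some integer $n\ge 2$, then $\varphi_2(x)=x$. (2) If $7\cdot 2^{2n-1}\le x<7\cdot 2^{2n}$ for some integer $n\ge2$, then $\varphi_2(x)=x\oplus 2$. Then, for all nonnegative integers $a,b$, the Halve Nim position $a^1b^12^1$ is a $\mathcal{P}$-position if and only if $b=\varphi_2(a)$. Furthermore, for $a,b\ge 30$, $a^1b^12^1$ is a $\mathcal{P}$-position if and only if $$a\oplus b=1+(-1)^{\lfloor\log_2(a/7)\rfloor+1}.$$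
   Context: $\mathbb{N}$ is the set of nonnegative integers and $\oplus$ denotes bitwise XOR. Halve Nim is a two-player game played on finitely many piles of coins; players alternate moves and a player who cannot move loses. A move is one of: (i) choose one pile and remove at least one coin from it; (ii) halve the game: simultaneously replace every pile of $m$ coins by a pile of $\lfloor m/2\rfloor$ coins. When there are no coins left, no move is available (halving requires at least one coin to be present). A position is a $\mathcal{P}$-position if the player who is not about to move has a winning strategy (equivalently, every move from it leads to an $\mathcal{N}$-position), and an $\mathcal{N}$-position if the player about to move has a winning strategy. $a^1b^1c^1$ denotes the position with three piles of sizes $a$, $b$, $c$ (a pile of size $0$ is an empty pile); in particular $a^1b^12^1$ has piles of sizes $a$, $b$, $2$. -}

module Defs where

open import Data.Empty using (⊥; ⊥-elim)
open import Data.Fin using (fromℕ<)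
open import Data.Integer as ℤ using (∣_∣)
import Data.Integer.Properties as ℤ
open import Data.List using (List; []; _∷_; map)
open import Data.List.Relation.Unary.Any using (Any)
open import Data.Nat
open import Data.Nat.DivMod using (_/_; _%_; m≡m%n+[m/n]*n; m%n<n; m/n*n≤m; m≥n⇒m/n>0)
open import Data.Nat.Logarithm
open import Data.Nat.Properties
open import Data.Product using (∃; _×_; _,_; proj₁; proj₂)
open import Data.Rational.Unnormalised as ℚᵘ using (ℚᵘ; mkℚᵘ; *≤*; *<*)
open import Data.Sum using (_⊎_; inj₁; inj₂)
open import Data.Vec using (Vec; []; _∷_; lookup)
open import Relation.Binary.PropositionalEquality
open import Relation.Nullary using (yes; no; contradiction)

xorBits : ℕ → ℕ → ℕ → ℕ
xorBits zero    m n = 0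
xorBits (suc k) m n = (m % 2 + n % 2) % 2 + 2 * xorBits k (m / 2) (n / 2)

-- Neither argument has more than m + n binary digits, so nothing is cut off.
infixl 6 _⊕_
_⊕_ : ℕ → ℕ → ℕ
m ⊕ n = xorBits (m + n) m n

-- Meaningful for q ≥ 1 only, where log₂ q is nonnegative; log₂ℚ-bounds shows
-- that taking the integer part of q first does not change the result.
⌊log₂ℚ_⌋ : ℚᵘ → ℕ
⌊log₂ℚ q ⌋ = ⌊log₂ ∣ ℚᵘ.floor q ∣ ⌋

private
  log₂-bounds : ∀ n → 1 ≤ n → 2 ^ ⌊log₂ n ⌋ ≤ n × n < 2 ^ suc ⌊log₂ n ⌋
  log₂-bounds n 1≤n = lower , upper
    where
    lower : 2 ^ ⌊log₂ n ⌋ ≤ n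
    lower = ≮⇒≥ λ n<2^k → go n ⌊log₂ n ⌋ 1≤n n<2^k refl
      where
      go : ∀ n k → 1 ≤ n → n < 2 ^ k → k ≡ ⌊log₂ n ⌋ → ⊥
      go n zero 1≤n n<1 eq = <⇒≱ n<1 1≤n
      go (suc zero) (suc k) 1≤n n<1 ()
      go n@(suc (suc m)) (suc k) _ n<2^k eq =
        go ⌊ n /2⌋ k (s≤s z≤n) (*-cancelˡ-< 2 _ _ (≤-<-trans half n<2^k))
          (trans (cong (_∸ 1) eq) (sym (⌊log₂⌊n/2⌋⌋≡⌊log₂n⌋∸1 n)))
        where
        half : 2 * ⌊ n /2⌋ ≤ n
        half = subst₂ _≤_ (cong (⌊ n /2⌋ +_) (sym (+-identityʳ _))) (⌊n/2⌋+⌈n/2⌉≡n n)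
                 (+-monoʳ-≤ ⌊ n /2⌋ (⌊n/2⌋≤⌈n/2⌉ n))
    upper : n < 2 ^ suc ⌊log₂ n ⌋
    upper = ≰⇒> λ 2^k≤n → 1+n≰n (subst (_≤ ⌊log₂ n ⌋) (⌊log₂[2^n]⌋≡n (suc ⌊log₂ n ⌋)) (⌊log₂⌋-mono-≤ 2^k≤n))

log₂ℚ-bounds : ∀ q → ℚᵘ.1ℚᵘ ℚᵘ.≤ q →
               (ℤ.+ (2 ^ ⌊log₂ℚ q ⌋)) ℚᵘ./ 1 ℚᵘ.≤ q × q ℚᵘ.< (ℤ.+ (2 ^ suc ⌊log₂ℚ q ⌋)) ℚᵘ./ 1
log₂ℚ-bounds (mkℚᵘ (ℤ.-[1+ _ ]) d) (*≤* ())
log₂ℚ-bounds q@(mkℚᵘ (ℤ.+ a) d-1) (*≤* 1≤q) = subst Bounds (sym step) 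
  ( *≤* (subst₂ ℤ._≤_ (ℤ.pos-* (2 ^ k) d) (ℤ.pos-* a 1) (ℤ.+≤+ lower))
  , *<* (subst₂ ℤ._<_ (ℤ.pos-* a 1) (ℤ.pos-* (2 ^ suc k) d) (ℤ.+<+ upper)) )
  where
  d = suc d-1
  Bounds : ℕ → Set
  Bounds k = (ℤ.+ (2 ^ k)) ℚᵘ./ 1 ℚᵘ.≤ q × q ℚᵘ.< (ℤ.+ (2 ^ suc k)) ℚᵘ./ 1
  k = ⌊log₂ (a / d) ⌋
  step : ⌊log₂ℚ q ⌋ ≡ k
  step = cong (λ z → ⌊log₂ ∣ z ∣ ⌋) (ℤ.*-identityˡ (ℤ.+ (a / d)))
  d≤a : d ≤ a
  d≤a = subst₂ _≤_ (*-identityˡ d) (*-identityʳ a)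
          (ℤ.drop‿+≤+ (subst₂ ℤ._≤_ (sym (ℤ.pos-* 1 d)) (sym (ℤ.pos-* a 1)) 1≤q))
  bounds = log₂-bounds (a / d) (m≥n⇒m/n>0 d≤a)
  lower : 2 ^ k * d ≤ a * 1
  lower = ≤-trans (*-monoˡ-≤ d (proj₁ bounds))
            (≤-trans (m/n*n≤m a d) (≤-reflexive (sym (*-identityʳ a))))
  upper : a * 1 < 2 ^ suc k * d
  upper = ≤-<-trans (≤-reflexive (trans (*-identityʳ a) (m≡m%n+[m/n]*n a d)))
            (<-≤-trans (+-monoˡ-< (a / d * d) (m%n<n a d)) (*-monoˡ-≤ d (proj₂ bounds)))

Position : Set
Position = List ℕ

data Take : Position → Position → Set where
  here  : ∀ {m n ps} → n < m → Take (m ∷ ps) (n ∷ ps)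
  there : ∀ {m ps qs} → Take ps qs → Take (m ∷ ps) (m ∷ qs)

infix 4 _⟶_
data _⟶_ : Position → Position → Set where
  take  : ∀ {ps qs} → Take ps qs → ps ⟶ qs
  halve : ∀ {ps} → Any (0 <_) ps → ps ⟶ map ⌊_/2⌋ ps

-- An element of 𝒫 p (𝒩 p) is a winning strategy for the player who is not
-- (who is) about to move; being inductive, it ends after finitely many moves.
mutual
  data 𝒫 (p : Position) : Set where
    answer : (∀ {q} → p ⟶ q → 𝒩 q) → 𝒫 p

  data 𝒩 (p : Position) : Set where
    move : ∀ {q} → p ⟶ q → 𝒫 q → 𝒩 p

smallValues : Vec ℕ 30
smallValues =
   1 ∷  0 ∷  2 ∷  4 ∷  3 ∷  6 ∷  5 ∷  7 ∷  8 ∷  9 ∷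
  10 ∷ 11 ∷ 12 ∷ 13 ∷ 18 ∷ 19 ∷ 20 ∷ 21 ∷ 14 ∷ 15 ∷
  16 ∷ 17 ∷ 26 ∷ 27 ∷ 28 ∷ 29 ∷ 22 ∷ 23 ∷ 24 ∷ 25 ∷ []

data Clause (x : ℕ) : Set where
  small   : x < 30 → Clause x
  middle  : 30 ≤ x → x < 56 → Clause x
  fixed   : ∀ n → 2 ≤ n → 7 * 2 ^ (2 * n) ≤ x → x < 7 * 2 ^ (2 * n + 1) → Clause x
  twisted : ∀ n → 2 ≤ n → 7 * 2 ^ (2 * n ∸ 1) ≤ x → x < 7 * 2 ^ (2 * n) → Clause x

value : ∀ {x} → Clause x → ℕ
value     (small x<30)      = lookup smallValues (fromℕ< x<30)
value {x} (middle _ _)      = x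
value {x} (fixed _ _ _ _)   = x
value {x} (twisted _ _ _ _) = x ⊕ 2

private
  bracket : ∀ d → ∃ λ k → 3 ≤ k × 7 * 2 ^ k ≤ 56 + d × 56 + d < 7 * 2 ^ suc k
  bracket zero    = 3 , ≤-refl , ≤-refl , m≤m+n 57 55
  bracket (suc d) with bracket d
  ... | k , 3≤k , lo , hi with 56 + suc d <? 7 * 2 ^ suc k
  ...   | yes hi′ = k , 3≤k , ≤-trans lo (+-monoʳ-≤ 56 (n≤1+n d)) , hi′
  ...   | no ¬hi′ = suc k , m≤n⇒m≤1+n 3≤k , ≮⇒≥ ¬hi′ ,
                    subst (_< 7 * 2 ^ suc (suc k)) (sym (+-suc 56 d))
                      (≤-<-trans hi (*-monoʳ-< 7 (^-monoʳ-< 2 (s≤s (s≤s z≤n)) (n<1+n (suc k)))))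

  halves : ∀ k → (∃ λ n → k ≡ 2 * n) ⊎ (∃ λ n → suc k ≡ 2 * n)
  halves zero = inj₁ (0 , refl)
  halves (suc k) with halves k
  ... | inj₁ (n , eq) = inj₂ (suc n , trans (cong (2 +_) eq) (sym (*-suc 2 n)))
  ... | inj₂ (n , eq) = inj₁ (n , eq)

  exponents : ∀ {x} i j → 7 * 2 ^ i ≤ x → x < 7 * 2 ^ j → i < j
  exponents i j lo hi = ≰⇒> λ j≤i →
    <⇒≱ (≤-<-trans lo hi) (*-monoʳ-≤ 7 (^-monoʳ-≤ 2 j≤i))

  two≤ : ∀ n → 3 ≤ 2 * n → 2 ≤ n
  two≤ n 3≤2n = *-cancelˡ-< 2 1 n 3≤2n

  large : ∀ {x} n → 2 ≤ n → 7 * 2 ^ (2 * n ∸ 1) ≤ x → 56 ≤ x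
  large n 2≤n lo = ≤-trans (*-monoʳ-≤ 7 (^-monoʳ-≤ 2 (∸-monoˡ-≤ 1 (*-monoʳ-≤ 2 2≤n)))) lo

  large′ : ∀ {x} n → 2 ≤ n → 7 * 2 ^ (2 * n) ≤ x → 56 ≤ x
  large′ n 2≤n lo =
    large n 2≤n (≤-trans (*-monoʳ-≤ 7 (^-monoʳ-≤ 2 (m∸n≤m (2 * n) 1))) lo)

  below30 : ∀ {x} → x < 30 → x < 56
  below30 x<30 = ≤-trans x<30 (m≤m+n 30 26)

  clash : ∀ {x} n m → 1 ≤ m →
          7 * 2 ^ (2 * n) ≤ x → x < 7 * 2 ^ (2 * n + 1) →
          7 * 2 ^ (2 * m ∸ 1) ≤ x → x < 7 * 2 ^ (2 * m) →
          ⊥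
  clash n (suc m) _ lo hi lo′ hi′ = contradiction n<m (<⇒≱ (s≤s m≤n))
    where
    n<m : n < suc m
    n<m = *-cancelˡ-< 2 n (suc m) (exponents (2 * n) (2 * suc m) lo hi′)
    m≤n : suc m ≤ n
    m≤n = s≤s⁻¹ (*-cancelˡ-< 2 (suc m) (suc n)
      (subst (2 * suc m <_) (trans (cong suc (+-comm (2 * n) 1)) (sym (*-suc 2 n)))
        (s≤s (exponents (2 * suc m ∸ 1) (2 * n + 1) lo′ hi))))

  fromBracket : ∀ {x} k → 3 ≤ k → 7 * 2 ^ k ≤ x → x < 7 * 2 ^ suc k → Clause x
  fromBracket {x} k 3≤k lo hi with halves k
  ... | inj₁ (n , refl) =
          fixed n (two≤ n 3≤k) lo (subst (λ j → x < 7 * 2 ^ j) (+-comm 1 (2 * n)) hi)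
  ... | inj₂ (n , eq)   =
          twisted n (two≤ n (subst (3 ≤_) eq (m≤n⇒m≤1+n 3≤k)))
            (subst (λ j → 7 * 2 ^ (j ∸ 1) ≤ x) eq lo)
            (subst (λ j → x < 7 * 2 ^ j) eq hi)

cover : ∀ x → Clause x
cover x with x <? 30
... | yes x<30 = small x<30
... | no  x≮30 with x <? 56
...   | yes x<56 = middle (≮⇒≥ x≮30) x<56
...   | no  x≮56 =
          let k , 3≤k , lo , hi = bracket (x ∸ 56)
          in subst Clause (m+[n∸m]≡n (≮⇒≥ x≮56)) (fromBracket k 3≤k lo hi)

-- The choice made by cover is immaterial: see value-unique.
φ₂ : ℕ → ℕ
φ₂ x = value (cover x)

value-unique : ∀ {x} (c d : Clause x) → value c ≡ value d
value-unique (small _)         (small _)         = refl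
value-unique (small x<30)      (middle 30≤x _)   = contradiction 30≤x (<⇒≱ x<30)
value-unique (small x<30)      (fixed n p lo _)  = contradiction (below30 x<30) (≤⇒≯ (large′ n p lo))
value-unique (small x<30)      (twisted n p lo _) = contradiction (below30 x<30) (≤⇒≯ (large n p lo))
value-unique (middle 30≤x _)   (small x<30)      = contradiction 30≤x (<⇒≱ x<30)
value-unique (middle _ _)      (middle _ _)      = refl
value-unique (middle _ _)      (fixed _ _ _ _)   = refl
value-unique (middle _ x<56)   (twisted n p lo _) = contradiction x<56 (≤⇒≯ (large n p lo))
value-unique (fixed n p lo _)  (small x<30)      = contradiction (below30 x<30) (≤⇒≯ (large′ n p lo))
value-unique (fixed _ _ _ _)   (middle _ _)      = refl
value-unique (fixed _ _ _ _)   (fixed _ _ _ _)   = refl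
value-unique (fixed n _ lo hi) (twisted m p lo′ hi′) = ⊥-elim (clash n m (<⇒≤ p) lo hi lo′ hi′)
value-unique (twisted n p lo _) (small x<30)     = contradiction (below30 x<30) (≤⇒≯ (large n p lo))
value-unique (twisted n p lo _) (middle _ x<56)  = contradiction x<56 (≤⇒≯ (large n p lo))
value-unique (twisted m p lo′ hi′) (fixed n _ lo hi) = ⊥-elim (clash n m (<⇒≤ p) lo hi lo′ hi′)
value-unique (twisted _ _ _ _) (twisted _ _ _ _) = refl

{-# OPTIONS --safe #-}

-- For each c ≤ 2 the 𝒫-positions (a, b, c) form the graph of an involution
-- a ↦ mate c a.  Beyond a finite table it is a ↦ a ⊕ mask (phase a) c, where
-- phase a is the parity of ⌊log₂ (a / 7)⌋: it changes only the last two binary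
-- digits of a, and halving a flips the phase.  The involutions for different c
-- nowhere agree, halving never carries a 𝒫-position to a 𝒫-position, and when
-- b < mate c a and a < mate c b, so that no move in the first two piles helps,
-- halving or a move in the third pile does.  Beyond 56 the last two inequalities
-- force a and b into the same block of four consecutive numbers, so each of these
-- facts is a check on a and b below 56 plus one on residues modulo 4.

module Submission where

open import Defs
open import Data.Integer as ℤ using (+_; -1ℤ)
import Data.Integer.Properties as ℤ
open import Data.List using ([]; _∷_)
open import Data.Nat using (ℕ; _+_; _≤_)
open import Data.Product using (_×_)
open import Data.Rational.Unnormalised using (_/_)
open import Function.Bundles using (_⇔_; mk⇔)
open import Function.Construct.Composition using (_⇔-∘_)

open import Data.Fin using (fromℕ<)
open import Data.List.Relation.Unary.Any using (Any; here; there)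
open import Data.Nat using (zero; suc; _*_; _^_; _∸_; s≤s⁻¹; _<_; _<?_; _≟_; ⌊_/2⌋;
  parity; s≤s; z≤n)
import Data.Nat.DivMod as ℕ
open import Data.Nat.DivMod using (_%_)
open import Data.Nat.Induction using (Acc; acc; <-wellFounded)
open import Data.Nat.Logarithm
open import Data.Nat.Properties
open import Data.Nat.Tactic.RingSolver using (solve-∀)
open import Data.Parity using (Parity; 0ℙ; 1ℙ; _⁻¹)
open import Data.Parity.Properties using (⁻¹-involutive; suc-homo-⁻¹; *-homo-*)
open import Data.Product using (_,_; ∃; proj₁; proj₂)
open import Data.Sum as Sum using (_⊎_)
open import Data.Vec using (Vec; []; _∷_; lookup)
open import Relation.Binary.Definitions using (tri<; tri≈; tri>)
open import Relation.Binary.PropositionalEquality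
  using (_≡_; _≢_; refl; sym; trans; cong; cong₂; subst; module ≡-Reasoning)
open import Relation.Nullary using (¬_; Dec; yes; no; contradiction; ¬?; _→-dec_; _×-dec_; _⊎-dec_)
open import Relation.Nullary.Decidable using (toWitness; map′; decidable-stable)

-- Phase, halving and last binary digits

phase : ℕ → Parity
phase n = parity ⌊log₂ (n ℕ./ 7) ⌋

split₂ : ∀ n → n ≡ n % 2 + 2 * (n ℕ./ 2)
split₂ n = trans (ℕ.m≡m%n+[m/n]*n n 2) (cong (λ x → n % 2 + x) (*-comm (n ℕ./ 2) 2))

⌊m+2k/2⌋ : ∀ m k → ⌊ m + 2 * k /2⌋ ≡ ⌊ m /2⌋ + k
⌊m+2k/2⌋ m zero    = trans (cong ⌊_/2⌋ (+-identityʳ m)) (sym (+-identityʳ ⌊ m /2⌋))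
⌊m+2k/2⌋ m (suc k) = begin
  ⌊ m + 2 * suc k /2⌋      ≡⟨ cong (λ x → ⌊ m + x /2⌋) (*-suc 2 k) ⟩
  ⌊ m + (2 + 2 * k) /2⌋    ≡⟨ cong ⌊_/2⌋ (+-suc m (1 + 2 * k)) ⟩
  ⌊ suc (m + suc (2 * k)) /2⌋ ≡⟨ cong (λ x → ⌊ suc x /2⌋) (+-suc m (2 * k)) ⟩
  suc ⌊ m + 2 * k /2⌋      ≡⟨ cong suc (⌊m+2k/2⌋ m k) ⟩
  suc (⌊ m /2⌋ + k)        ≡⟨ +-suc ⌊ m /2⌋ k ⟨
  ⌊ m /2⌋ + suc k          ∎
  where open ≡-Reasoning

⌊bit/2⌋≡0 : ∀ {i} → i < 2 → ⌊ i /2⌋ ≡ 0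
⌊bit/2⌋≡0 {0} _ = refl
⌊bit/2⌋≡0 {1} _ = refl
⌊bit/2⌋≡0 {suc (suc _)} (s≤s (s≤s ()))

⌊n/2⌋≡n/2 : ∀ n → ⌊ n /2⌋ ≡ n ℕ./ 2
⌊n/2⌋≡n/2 n = begin
  ⌊ n /2⌋                        ≡⟨ cong ⌊_/2⌋ (split₂ n) ⟩
  ⌊ n % 2 + 2 * (n ℕ./ 2) /2⌋    ≡⟨ ⌊m+2k/2⌋ (n % 2) (n ℕ./ 2) ⟩
  ⌊ n % 2 /2⌋ + n ℕ./ 2          ≡⟨ cong (_+ n ℕ./ 2) (⌊bit/2⌋≡0 (ℕ.m%n<n n 2)) ⟩
  n ℕ./ 2                        ∎
  where open ≡-Reasoning

[i+2m]/2≡m : ∀ {i} m → i < 2 → (i + 2 * m) ℕ./ 2 ≡ m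
[i+2m]/2≡m {i} m i<2 = begin
  (i + 2 * m) ℕ./ 2   ≡⟨ ⌊n/2⌋≡n/2 (i + 2 * m) ⟨
  ⌊ i + 2 * m /2⌋     ≡⟨ ⌊m+2k/2⌋ i m ⟩
  ⌊ i /2⌋ + m         ≡⟨ cong (_+ m) (⌊bit/2⌋≡0 i<2) ⟩
  m                   ∎
  where open ≡-Reasoning

[i+2m]%2≡i : ∀ {i} m → i < 2 → (i + 2 * m) % 2 ≡ i
[i+2m]%2≡i {i} m i<2 = begin
  (i + 2 * m) % 2   ≡⟨ cong (λ x → (i + x) % 2) (*-comm 2 m) ⟩
  (i + m * 2) % 2   ≡⟨ ℕ.[m+kn]%n≡m%n i m 2 ⟩
  i % 2             ≡⟨ ℕ.m<n⇒m%n≡m i<2 ⟩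
  i                 ∎
  where open ≡-Reasoning

halves-decrease : ∀ {k} m n → m + n ≤ suc k → m ℕ./ 2 + n ℕ./ 2 ≤ k
halves-decrease zero zero _ = z≤n
halves-decrease (suc m) n le =
  s≤s⁻¹ (≤-trans (+-mono-<-≤ (ℕ.m/n<m (suc m) 2 ≤-refl) (ℕ.m/n≤m n 2)) le)
halves-decrease zero (suc n) le = s≤s⁻¹ (≤-trans (ℕ.m/n<m (suc n) 2 ≤-refl) le)

-- Bitwise XOR

xorBits-zero : ∀ k → xorBits k 0 0 ≡ 0
xorBits-zero zero    = refl
xorBits-zero (suc k) = cong (2 *_) (xorBits-zero k)

-- The sum of the arguments drops whenever both are halved, so `m + n` rounds reach two zeros;
-- surplus rounds only add leading zero digits.
xorBits-stable : ∀ k l m n → m + n ≤ k → m + n ≤ l → xorBits k m n ≡ xorBits l m n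
xorBits-stable zero    l       zero zero _ _ = sym (xorBits-zero l)
xorBits-stable (suc k) zero    zero zero _ _ = xorBits-zero (suc k)
xorBits-stable (suc k) (suc l) m    n    p q =
  cong (λ x → (m % 2 + n % 2) % 2 + 2 * x)
    (xorBits-stable k l (m ℕ./ 2) (n ℕ./ 2) (halves-decrease m n p) (halves-decrease m n q))

⊕-unfold : ∀ m n → m ⊕ n ≡ (m % 2 + n % 2) % 2 + 2 * (m ℕ./ 2 ⊕ n ℕ./ 2)
⊕-unfold m n = trans
  -- One extra round exposes the last digit; the remaining `m + n` rounds are then traded for the
  -- number that `⊕` prescribes for the halves.
  (xorBits-stable (m + n) (suc (m + n)) m n ≤-refl (n≤1+n (m + n)))
  (cong (λ x → (m % 2 + n % 2) % 2 + 2 * x)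
    (xorBits-stable (m + n) (m ℕ./ 2 + n ℕ./ 2) (m ℕ./ 2) (n ℕ./ 2)
      (+-mono-≤ (ℕ.m/n≤m m 2) (ℕ.m/n≤m n 2)) ≤-refl))

⊕-cons : ∀ {i j} m n → i < 2 → j < 2 → (i + 2 * m) ⊕ (j + 2 * n) ≡ (i + j) % 2 + 2 * (m ⊕ n)
⊕-cons {i} {j} m n i<2 j<2 = trans (⊕-unfold (i + 2 * m) (j + 2 * n))
  (cong₂ (λ x y → x % 2 + 2 * y)
    (cong₂ _+_ ([i+2m]%2≡i m i<2) ([i+2m]%2≡i n j<2))
    (cong₂ _⊕_ ([i+2m]/2≡m m i<2) ([i+2m]/2≡m n j<2)))

[i+[i+j]%2]%2≡j : ∀ {i j} → i < 2 → j < 2 → (i + (i + j) % 2) % 2 ≡ j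
[i+[i+j]%2]%2≡j {i} {j} i<2 j<2 = toWitness
  {a? = allUpTo? (λ i → allUpTo? (λ j → (i + (i + j) % 2) % 2 ≟ j) 2) 2} _ i<2 j<2

⊕-cancelˡ : ∀ m n → m ⊕ (m ⊕ n) ≡ n
⊕-cancelˡ m n = go (m + n) m n ≤-refl
  where
  open ≡-Reasoning
  go : ∀ k m n → m + n ≤ k → m ⊕ (m ⊕ n) ≡ n
  go zero    zero zero _  = refl
  go (suc k) m    n    le = begin
    m ⊕ (m ⊕ n)
      ≡⟨ cong₂ _⊕_ (split₂ m) (⊕-unfold m n) ⟩
    (i + 2 * (m ℕ./ 2)) ⊕ ((i + j) % 2 + 2 * (m ℕ./ 2 ⊕ n ℕ./ 2))
      ≡⟨ ⊕-cons (m ℕ./ 2) (m ℕ./ 2 ⊕ n ℕ./ 2) (ℕ.m%n<n m 2) (ℕ.m%n<n (i + j) 2) ⟩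
    (i + (i + j) % 2) % 2 + 2 * (m ℕ./ 2 ⊕ (m ℕ./ 2 ⊕ n ℕ./ 2))
      ≡⟨ cong₂ (λ x y → x + 2 * y) ([i+[i+j]%2]%2≡j (ℕ.m%n<n m 2) (ℕ.m%n<n n 2))
           (go k (m ℕ./ 2) (n ℕ./ 2) (halves-decrease m n le)) ⟩
    j + 2 * (n ℕ./ 2)
      ≡⟨ split₂ n ⟨
    n ∎
    where
    i = m % 2
    j = n % 2

⊕-identityʳ : ∀ n → n ⊕ 0 ≡ n
⊕-identityʳ n = go n n ≤-refl
  where
  open ≡-Reasoning
  go : ∀ k n → n ≤ k → n ⊕ 0 ≡ n
  go zero    zero _  = refl
  go (suc k) n    le = begin
    n ⊕ 0                                ≡⟨ ⊕-unfold n 0 ⟩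
    (n % 2 + 0) % 2 + 2 * (n ℕ./ 2 ⊕ 0)
      ≡⟨ cong₂ (λ x y → x % 2 + 2 * y) (+-identityʳ (n % 2))
           (go k (n ℕ./ 2) (subst (_≤ k) (+-identityʳ (n ℕ./ 2))
             (halves-decrease n 0 (subst (_≤ suc k) (sym (+-identityʳ n)) le)))) ⟩
    n % 2 % 2 + 2 * (n ℕ./ 2)            ≡⟨ cong (_+ 2 * (n ℕ./ 2)) (ℕ.m%n%n≡m%n n 2) ⟩
    n % 2 + 2 * (n ℕ./ 2)                ≡⟨ split₂ n ⟨
    n                                    ∎

split₄ : ∀ i j q → (i + 2 * j) + 4 * q ≡ i + 2 * (j + 2 * q)
split₄ = solve-∀

-- A number `d` below 4 has two digits only, so every higher digit meets a 0 and the block index `q`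
-- survives.
⊕-block : ∀ {r d} q → r < 4 → d < 4 → (r + 4 * q) ⊕ d ≡ (r ⊕ d) + 4 * q
⊕-block {r} {d} q r<4 d<4 = begin
  (r + 4 * q) ⊕ d
    ≡⟨ cong₂ (λ x y → (x + 4 * q) ⊕ y) (split₂ r) (split₂ d) ⟩
  (i + 2 * i′ + 4 * q) ⊕ (j + 2 * j′)
    ≡⟨ cong (_⊕ (j + 2 * j′)) (split₄ i i′ q) ⟩
  (i + 2 * (i′ + 2 * q)) ⊕ (j + 2 * j′)
    ≡⟨ ⊕-cons (i′ + 2 * q) j′ (ℕ.m%n<n r 2) (ℕ.m%n<n d 2) ⟩
  (i + j) % 2 + 2 * ((i′ + 2 * q) ⊕ j′)
    -- A leading zero is supplied to `j′` so that `⊕-cons` applies a second time.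
    ≡⟨ cong (λ x → (i + j) % 2 + 2 * ((i′ + 2 * q) ⊕ x)) (+-identityʳ j′) ⟨
  (i + j) % 2 + 2 * ((i′ + 2 * q) ⊕ (j′ + 2 * 0))
    ≡⟨ cong (λ x → (i + j) % 2 + 2 * x) (⊕-cons q 0 i′<2 j′<2) ⟩
  (i + j) % 2 + 2 * ((i′ + j′) % 2 + 2 * (q ⊕ 0))
    ≡⟨ cong (λ x → (i + j) % 2 + 2 * ((i′ + j′) % 2 + 2 * x)) (⊕-identityʳ q) ⟩
  (i + j) % 2 + 2 * ((i′ + j′) % 2 + 2 * q)
    ≡⟨ split₄ ((i + j) % 2) ((i′ + j′) % 2) q ⟨
  (i + j) % 2 + 2 * ((i′ + j′) % 2) + 4 * q
    ≡⟨ cong (_+ 4 * q) (bits r<4 d<4) ⟩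
  (r ⊕ d) + 4 * q ∎
  where
  open ≡-Reasoning
  i = r % 2
  i′ = r ℕ./ 2
  j = d % 2
  j′ = d ℕ./ 2
  i′<2 : i′ < 2
  i′<2 = ℕ.m<n*o⇒m/o<n r<4
  j′<2 : j′ < 2
  j′<2 = ℕ.m<n*o⇒m/o<n d<4
  bits : ∀ {r} → r < 4 → ∀ {d} → d < 4 →
         (r % 2 + d % 2) % 2 + 2 * ((r ℕ./ 2 + d ℕ./ 2) % 2) ≡ r ⊕ d
  bits = toWitness
    {a? = allUpTo? (λ r → allUpTo? (λ d →
            (r % 2 + d % 2) % 2 + 2 * ((r ℕ./ 2 + d ℕ./ 2) % 2) ≟ r ⊕ d) 4) 4} _

-- Binary logarithm and phase

⌊log₂⌋-halve : ∀ {n} → 2 ≤ n → ⌊log₂ n ⌋ ≡ suc ⌊log₂ (n ℕ./ 2) ⌋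
⌊log₂⌋-halve {n} 2≤n = begin
  ⌊log₂ n ⌋                  ≡⟨ m+[n∸m]≡n (⌊log₂⌋-mono-≤ 2≤n) ⟨
  suc (⌊log₂ n ⌋ ∸ 1)        ≡⟨ cong suc (⌊log₂⌊n/2⌋⌋≡⌊log₂n⌋∸1 n) ⟨
  suc ⌊log₂ ⌊ n /2⌋ ⌋        ≡⟨ cong (λ x → suc ⌊log₂ x ⌋) (⌊n/2⌋≡n/2 n) ⟩
  suc ⌊log₂ (n ℕ./ 2) ⌋      ∎
  where open ≡-Reasoning

⌊log₂⌋-unique : ∀ k {n} → 2 ^ k ≤ n → n < 2 ^ suc k → ⌊log₂ n ⌋ ≡ k
⌊log₂⌋-unique zero    {n} 1≤n n<2 = cong ⌊log₂_⌋ (≤-antisym (s≤s⁻¹ n<2) 1≤n)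
⌊log₂⌋-unique (suc k) {n} lo  hi  = trans (⌊log₂⌋-halve (≤-trans (m≤m*n 2 (2 ^ k) {{m^n≢0 2 k}}) lo))
  (cong suc (⌊log₂⌋-unique k
    (subst (_≤ n ℕ./ 2) (trans (cong (ℕ._/ 2) (*-comm 2 (2 ^ k))) (ℕ.m*n/n≡m (2 ^ k) 2))
      (ℕ./-monoˡ-≤ 2 lo))
    (ℕ.m<n*o⇒m/o<n (subst (n <_) (*-comm 2 (2 ^ suc k)) hi))))

-- Division by 7 commutes with division by 2, so appending a binary digit to `q` adds one to the
-- logarithm of the quotient. The bound `7 ≤ q` keeps that quotient positive before and at least 2
-- after.
phase-double : ∀ {h q} → h < 2 → 7 ≤ q → phase (h + 2 * q) ≡ phase q ⁻¹
phase-double {h} {q} h<2 7≤q = begin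
  phase n                              ≡⟨ cong parity (⌊log₂⌋-halve 2≤n/7) ⟩
  parity (suc ⌊log₂ (n ℕ./ 7 ℕ./ 2) ⌋) ≡⟨ cong (λ x → parity (suc ⌊log₂ x ⌋)) n/7/2≡q/7 ⟩
  parity (suc ⌊log₂ (q ℕ./ 7) ⌋)       ≡⟨ suc-homo-⁻¹ (suc ⌊log₂ (q ℕ./ 7) ⌋) ⟨
  phase q ⁻¹                           ∎
  where
  open ≡-Reasoning
  n = h + 2 * q
  2≤n/7 : 2 ≤ n ℕ./ 7
  2≤n/7 = ℕ./-monoˡ-≤ 7 (≤-trans (*-monoʳ-≤ 2 7≤q) (m≤n+m (2 * q) h))
  n/7/2≡q/7 : n ℕ./ 7 ℕ./ 2 ≡ q ℕ./ 7
  n/7/2≡q/7 = begin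
    n ℕ./ 7 ℕ./ 2   ≡⟨ ℕ.m/n/o≡m/[n*o] n 7 2 ⟩
    n ℕ./ 14        ≡⟨ ℕ.m/n/o≡m/[n*o] n 2 7 ⟨
    n ℕ./ 2 ℕ./ 7   ≡⟨ cong (ℕ._/ 7) ([i+2m]/2≡m q h<2) ⟩
    q ℕ./ 7         ∎

-- Appending two digits flips the phase twice. Hence the phase is constant on a block of four and
-- equals that of the block index.
phase-block : ∀ {r q} → r < 4 → 7 ≤ q → phase (r + 4 * q) ≡ phase q
phase-block {r} {q} r<4 7≤q = begin
  phase (r + 4 * q)                           ≡⟨ cong (λ x → phase (x + 4 * q)) (split₂ r) ⟩
  phase (r % 2 + 2 * (r ℕ./ 2) + 4 * q)       ≡⟨ cong phase (split₄ (r % 2) (r ℕ./ 2) q) ⟩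
  phase (r % 2 + 2 * (r ℕ./ 2 + 2 * q))       ≡⟨ phase-double (ℕ.m%n<n r 2) 7≤ ⟩
  phase (r ℕ./ 2 + 2 * q) ⁻¹                  ≡⟨ cong _⁻¹ (phase-double {r ℕ./ 2} (ℕ.m<n*o⇒m/o<n r<4) 7≤q) ⟩
  phase q ⁻¹ ⁻¹                               ≡⟨ ⁻¹-involutive (phase q) ⟩
  phase q                                     ∎
  where
  open ≡-Reasoning
  7≤ : 7 ≤ r ℕ./ 2 + 2 * q
  7≤ = ≤-trans 7≤q (≤-trans (m≤m+n q (q + 0)) (m≤n+m (2 * q) (r ℕ./ 2)))

-- The involutions

-- The masks of 0, 1, 2 are 2, 3, 0 in even phase and 0, 1, 2 in odd phase: three distinct numbers
-- below 4 each time.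
mask : Parity → ℕ → ℕ
mask 0ℙ c = c ⊕ 2
mask 1ℙ c = c

-- Of use for c ≤ 2 only.
initialValues : ℕ → Vec ℕ 30
initialValues 0 =
   0 ∷  2 ∷  1 ∷  3 ∷  4 ∷  5 ∷  8 ∷  9 ∷  6 ∷  7 ∷
  12 ∷ 13 ∷ 10 ∷ 11 ∷ 14 ∷ 15 ∷ 16 ∷ 17 ∷ 18 ∷ 19 ∷
  20 ∷ 21 ∷ 22 ∷ 23 ∷ 24 ∷ 25 ∷ 26 ∷ 27 ∷ 30 ∷ 31 ∷ []
initialValues 1 =
   2 ∷  3 ∷  0 ∷  1 ∷  5 ∷  4 ∷  9 ∷  8 ∷  7 ∷  6 ∷
  13 ∷ 12 ∷ 11 ∷ 10 ∷ 15 ∷ 14 ∷ 17 ∷ 16 ∷ 19 ∷ 18 ∷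
  21 ∷ 20 ∷ 23 ∷ 22 ∷ 25 ∷ 24 ∷ 27 ∷ 26 ∷ 31 ∷ 30 ∷ []
initialValues _ = smallValues

mate : ℕ → ℕ → ℕ
mate c a with a <? 30
... | yes a<30 = lookup (initialValues c) (fromℕ< a<30)
... | no  _    = a ⊕ mask (phase a) c

-- Checks by evaluation below 56

-- The bound 56 is twice 28, the point from which `mate 0` and `mate 1` follow the mask formula:
-- from 56 on, the formula governs a number as well as its half.
small-involutive : ∀ {c} → c < 3 → ∀ {a} → a < 56 → mate c (mate c a) ≡ a
small-involutive = toWitness
  {a? = allUpTo? (λ c → allUpTo? (λ a → mate c (mate c a) ≟ a) 56) 3} _

small-bounded : ∀ {c} → c < 3 → ∀ {a} → a < 56 → mate c a < 56
small-bounded = toWitness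
  {a? = allUpTo? (λ c → allUpTo? (λ a → mate c a <? 56) 56) 3} _

small-disjoint : ∀ {c} → c < 3 → ∀ {c′} → c′ < c → ∀ {a} → a < 56 → mate c a ≢ mate c′ a
small-disjoint = toWitness
  {a? = allUpTo? (λ c → allUpTo? (λ c′ → allUpTo? (λ a → ¬? (mate c a ≟ mate c′ a)) 56) c) 3} _

-- The condition `0 < a + c` leaves out the empty position, which is its own half but admits no
-- move.
small-quiet : ∀ {c} → c < 3 → ∀ {a} → a < 56 → 0 < a + c →
              ⌊ mate c a /2⌋ ≢ mate ⌊ c /2⌋ ⌊ a /2⌋
small-quiet = toWitness
  {a? = allUpTo? (λ c → allUpTo? (λ a → 0 <? a + c →-dec
          ¬? (⌊ mate c a /2⌋ ≟ mate ⌊ c /2⌋ ⌊ a /2⌋)) 56) 3} _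

small-forced : ∀ {c} → c < 3 → ∀ {a} → a < 56 → ∀ {b} → b < 56 →
               b < mate c a → a < mate c b →
               (∃ λ c′ → c′ < c × b ≡ mate c′ a) ⊎ ⌊ b /2⌋ ≡ mate ⌊ c /2⌋ ⌊ a /2⌋
small-forced = toWitness
  {a? = allUpTo? (λ c → allUpTo? (λ a → allUpTo? (λ b →
          b <? mate c a →-dec (a <? mate c b →-dec
          (anyUpTo? (λ c′ → b ≟ mate c′ a) c ⊎-dec
           ⌊ b /2⌋ ≟ mate ⌊ c /2⌋ ⌊ a /2⌋))) 56) 56) 3} _

-- The involutions on blocks of four

mate-large : ∀ c {a} → 30 ≤ a → mate c a ≡ a ⊕ mask (phase a) c
mate-large c {a} 30≤a with a <? 30
... | yes a<30 = contradiction 30≤a (<⇒≱ a<30)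
... | no  _    = refl

mask-bounded : ∀ p {c} → c < 3 → mask p c < 4
mask-bounded 0ℙ = toWitness {a? = allUpTo? (λ c → mask 0ℙ c <? 4) 3} _
mask-bounded 1ℙ = m<n⇒m<1+n

mate-block : ∀ {c r q} → c < 3 → r < 4 → 7 ≤ q → 30 ≤ r + 4 * q →
             mate c (r + 4 * q) ≡ (r ⊕ mask (phase q) c) + 4 * q
mate-block {c} {r} {q} c<3 r<4 7≤q 30≤ = begin
  mate c (r + 4 * q)                             ≡⟨ mate-large c 30≤ ⟩
  (r + 4 * q) ⊕ mask (phase (r + 4 * q)) c       ≡⟨ cong (λ p → (r + 4 * q) ⊕ mask p c) (phase-block r<4 7≤q) ⟩
  (r + 4 * q) ⊕ mask (phase q) c                 ≡⟨ ⊕-block q r<4 (mask-bounded (phase q) c<3) ⟩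
  (r ⊕ mask (phase q) c) + 4 * q                 ∎
  where open ≡-Reasoning

-- For `c < 2` the tabulated values at 28 and 29 already agree with the mask formula, so the whole
-- block from 28 to 31 may be included. Halves of numbers from 56 on can fall there, with third pile
-- at most 1.
mate-block′ : ∀ {c r q} → c < 2 → r < 4 → 7 ≤ q →
              mate c (r + 4 * q) ≡ (r ⊕ mask (phase q) c) + 4 * q
mate-block′ {c} {r} {q} c<2 r<4 7≤q with q <? 8
... | no  q≮8 = mate-block (m<n⇒m<1+n c<2) r<4 7≤q
                  (≤-trans (m≤n+m 30 2) (≤-trans (*-monoʳ-≤ 4 (≮⇒≥ q≮8)) (m≤n+m (4 * q) r)))
... | yes q<8 = first-block c<2 r<4 q<8 7≤q
  where
  first-block : ∀ {c} → c < 2 → ∀ {r} → r < 4 → ∀ {q} → q < 8 → 7 ≤ q →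
                mate c (r + 4 * q) ≡ (r ⊕ mask (phase q) c) + 4 * q
  first-block = toWitness
    {a? = allUpTo? (λ c → allUpTo? (λ r → allUpTo? (λ q → 7 ≤? q →-dec
            mate c (r + 4 * q) ≟ (r ⊕ mask (phase q) c) + 4 * q) 8) 4) 2} _

-- Checks on residues modulo 4

bothParities? : {P : Parity → Set} → (∀ p → Dec (P p)) → Dec (∀ p → P p)
bothParities? P? = map′ (λ { (p₀ , p₁) 0ℙ → p₀ ; (p₀ , p₁) 1ℙ → p₁ }) (λ f → f 0ℙ , f 1ℙ)
                     (P? 0ℙ ×-dec P? 1ℙ)

block-bounded : ∀ p {c} → c < 3 → ∀ {r} → r < 4 → r ⊕ mask p c < 4
block-bounded = toWitness
  {a? = bothParities? λ p → allUpTo? (λ c → allUpTo? (λ r → r ⊕ mask p c <? 4) 4) 3} _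

block-involutive : ∀ p {c} → c < 3 → ∀ {r} → r < 4 → (r ⊕ mask p c) ⊕ mask p c ≡ r
block-involutive = toWitness
  {a? = bothParities? λ p → allUpTo? (λ c → allUpTo? (λ r →
          (r ⊕ mask p c) ⊕ mask p c ≟ r) 4) 3} _

block-disjoint : ∀ p {c} → c < 3 → ∀ {c′} → c′ < c → ∀ {r} → r < 4 → r ⊕ mask p c ≢ r ⊕ mask p c′
block-disjoint = toWitness
  {a? = bothParities? λ p → allUpTo? (λ c → allUpTo? (λ c′ → allUpTo? (λ r →
          ¬? (r ⊕ mask p c ≟ r ⊕ mask p c′)) 4) c) 3} _

-- Here `p` is the phase after halving and `p ⁻¹` the one before. For c = 0, 1, 2 the halved masks
-- are 1, 1, 0 or 0, 0, 1, while a 𝒫-position after halving would need 0, 0, 1 or 2, 2, 3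
-- respectively.
block-quiet : ∀ p {c} → c < 3 → ∀ {h} → h < 2 → ∀ {r} → r < 4 →
              ⌊ r ⊕ mask (p ⁻¹) c /2⌋ + 2 * h ≢ (⌊ r /2⌋ + 2 * h) ⊕ mask p ⌊ c /2⌋
block-quiet = toWitness
  {a? = bothParities? λ p → allUpTo? (λ c → allUpTo? (λ h → allUpTo? (λ r →
          ¬? (⌊ r ⊕ mask (p ⁻¹) c /2⌋ + 2 * h ≟ (⌊ r /2⌋ + 2 * h) ⊕ mask p ⌊ c /2⌋)) 4) 2) 3} _

-- If the phase `p ⁻¹` is odd, the inequalities give `r ⊕ s < c`, and the third pile can be lowered
-- to `r ⊕ s`. If it is even, c = 2 is impossible, and either c = 1 with `s ≡ r ⊕ 2`, so that
-- emptying the third pile works, or `r` and `s` have equal halves and halving works.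
block-forced : ∀ p {c} → c < 3 → ∀ {h} → h < 2 → ∀ {r} → r < 4 → ∀ {s} → s < 4 →
               s < r ⊕ mask (p ⁻¹) c → r < s ⊕ mask (p ⁻¹) c →
               (∃ λ c′ → c′ < c × s ≡ r ⊕ mask (p ⁻¹) c′) ⊎
               ⌊ s /2⌋ + 2 * h ≡ (⌊ r /2⌋ + 2 * h) ⊕ mask p ⌊ c /2⌋
block-forced = toWitness
  {a? = bothParities? λ p → allUpTo? (λ c → allUpTo? (λ h → allUpTo? (λ r → allUpTo? (λ s →
          s <? r ⊕ mask (p ⁻¹) c →-dec (r <? s ⊕ mask (p ⁻¹) c →-dec
          (anyUpTo? (λ c′ → s ≟ r ⊕ mask (p ⁻¹) c′) c ⊎-dec
           ⌊ s /2⌋ + 2 * h ≟ (⌊ r /2⌋ + 2 * h) ⊕ mask p ⌊ c /2⌋))) 4) 4) 2) 3} _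

-- Decomposition of numbers from 56 on

-- In the large case `r` is the residue modulo 4, `h` the last digit of the block index and `q` the
-- block index of the half, whose residue is `⌊ r /2⌋ + 2 * h`. The bound `7 ≤ q` expresses that the
-- number is at least 56.
data Size : ℕ → Set where
  small : ∀ {a} → a < 56 → Size a
  large : ∀ {r h q} → r < 4 → h < 2 → 7 ≤ q → Size (r + 4 * (h + 2 * q))

size : ∀ a → Size a
size a with a <? 56
... | yes a<56 = small a<56
... | no  a≮56 = subst Size a≡ (large (ℕ.m%n<n a 4) (ℕ.m%n<n (a ℕ./ 4) 2)
                   (ℕ./-monoˡ-≤ 2 (ℕ./-monoˡ-≤ 4 (≮⇒≥ a≮56))))
  where
  open ≡-Reasoning
  a≡ : a % 4 + 4 * (a ℕ./ 4 % 2 + 2 * (a ℕ./ 4 ℕ./ 2)) ≡ a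
  a≡ = begin
    a % 4 + 4 * (a ℕ./ 4 % 2 + 2 * (a ℕ./ 4 ℕ./ 2))  ≡⟨ cong (λ x → a % 4 + 4 * x) (split₂ (a ℕ./ 4)) ⟨
    a % 4 + 4 * (a ℕ./ 4)                            ≡⟨ cong (λ x → a % 4 + x) (*-comm 4 (a ℕ./ 4)) ⟩
    a % 4 + a ℕ./ 4 * 4                              ≡⟨ ℕ.m≡m%n+[m/n]*n a 4 ⟨
    a                                                ∎

block-≤ : ∀ {r s m n} → s < 4 → r + 4 * m < s + 4 * n → m ≤ n
block-≤ {r} {s} {m} {n} s<4 lt = ≮⇒≥ λ n<m → <-irrefl refl (begin-strict
  r + 4 * m   <⟨ lt ⟩
  s + 4 * n   <⟨ +-monoˡ-< (4 * n) s<4 ⟩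
  4 + 4 * n   ≡⟨ *-suc 4 n ⟨
  4 * suc n   ≤⟨ *-monoʳ-≤ 4 n<m ⟩
  4 * m       ≤⟨ m≤n+m (4 * m) r ⟩
  r + 4 * m   ∎)
  where open ≤-Reasoning

⌊block/2⌋ : ∀ r h q → ⌊ r + 4 * (h + 2 * q) /2⌋ ≡ (⌊ r /2⌋ + 2 * h) + 4 * q
⌊block/2⌋ r h q = begin
  ⌊ r + 4 * (h + 2 * q) /2⌋      ≡⟨ cong (λ x → ⌊ r + x /2⌋) (double h q) ⟩
  ⌊ r + 2 * (2 * h + 4 * q) /2⌋  ≡⟨ ⌊m+2k/2⌋ r (2 * h + 4 * q) ⟩
  ⌊ r /2⌋ + (2 * h + 4 * q)      ≡⟨ +-assoc ⌊ r /2⌋ (2 * h) (4 * q) ⟨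
  (⌊ r /2⌋ + 2 * h) + 4 * q      ∎
  where
  open ≡-Reasoning
  double : ∀ h q → 4 * (h + 2 * q) ≡ 2 * (2 * h + 4 * q)
  double = solve-∀

half-block : ∀ {r h} → r < 4 → h < 2 → ⌊ r /2⌋ + 2 * h < 4
half-block r<4 h<2 = toWitness
  {a? = allUpTo? (λ r → allUpTo? (λ h → ⌊ r /2⌋ + 2 * h <? 4) 2) 4} _ r<4 h<2

halved<2 : ∀ {c} → c < 3 → ⌊ c /2⌋ < 2
halved<2 = toWitness {a? = allUpTo? (λ c → ⌊ c /2⌋ <? 2) 3} _

56≤block : ∀ r h {q} → 7 ≤ q → 56 ≤ r + 4 * (h + 2 * q)
56≤block r h {q} 7≤q = ≤-trans (*-monoʳ-≤ 4 (≤-trans (*-monoʳ-≤ 2 7≤q) (m≤n+m (2 * q) h)))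
                         (m≤n+m (4 * (h + 2 * q)) r)

-- The four facts from 56 on

module _ {c h q} (c<3 : c < 3) (h<2 : h < 2) (7≤q : 7 ≤ q) where
  private
    Q = h + 2 * q

    7≤Q : 7 ≤ Q
    7≤Q = ≤-trans 7≤q (≤-trans (m≤m+n q (q + 0)) (m≤n+m (2 * q) h))

  mate-large-block : ∀ {c r} → c < 3 → r < 4 → mate c (r + 4 * Q) ≡ (r ⊕ mask (phase Q) c) + 4 * Q
  mate-large-block {_} {r} c<3 r<4 =
    mate-block c<3 r<4 7≤Q (≤-trans (m≤m+n 30 26) (56≤block r h 7≤q))

  large-involutive : ∀ {r} → r < 4 → mate c (mate c (r + 4 * Q)) ≡ r + 4 * Q
  large-involutive {r} r<4 = begin
    mate c (mate c (r + 4 * Q))                             ≡⟨ cong (mate c) (mate-large-block c<3 r<4) ⟩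
    mate c ((r ⊕ mask p c) + 4 * Q)                         ≡⟨ mate-large-block c<3 (block-bounded p c<3 r<4) ⟩
    ((r ⊕ mask p c) ⊕ mask p c) + 4 * Q                     ≡⟨ cong (_+ 4 * Q) (block-involutive p c<3 r<4) ⟩
    r + 4 * Q                                               ∎
    where
    open ≡-Reasoning
    p = phase Q

  large-disjoint : ∀ {r c′} → r < 4 → c′ < c → mate c (r + 4 * Q) ≢ mate c′ (r + 4 * Q)
  large-disjoint r<4 c′<c eq = block-disjoint (phase Q) c<3 c′<c r<4
    (+-cancelʳ-≡ (4 * Q) _ _
      (trans (sym (mate-large-block c<3 r<4))
        (trans eq (mate-large-block (<-trans c′<c c<3) r<4))))

  -- The half lies in block `q`, so its mask is taken in `phase q`, opposite to the phase of `Q`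
  -- that governs the number itself.
  half-mate : ∀ {r} → r < 4 → mate ⌊ c /2⌋ ⌊ r + 4 * Q /2⌋ ≡
              ((⌊ r /2⌋ + 2 * h) ⊕ mask (phase q) ⌊ c /2⌋) + 4 * q
  half-mate {r} r<4 = trans (cong (mate ⌊ c /2⌋) (⌊block/2⌋ r h q))
    (mate-block′ (halved<2 c<3) (half-block r<4 h<2) 7≤q)

  large-quiet : ∀ {r} → r < 4 → ⌊ mate c (r + 4 * Q) /2⌋ ≢ mate ⌊ c /2⌋ ⌊ r + 4 * Q /2⌋
  large-quiet {r} r<4 eq = block-quiet (phase q) c<3 h<2 r<4 (+-cancelʳ-≡ (4 * q) _ _ (begin
    (⌊ r ⊕ mask (phase q ⁻¹) c /2⌋ + 2 * h) + 4 * q     ≡⟨ ⌊block/2⌋ (r ⊕ mask (phase q ⁻¹) c) h q ⟨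
    ⌊ (r ⊕ mask (phase q ⁻¹) c) + 4 * Q /2⌋             ≡⟨ cong (λ p → ⌊ (r ⊕ mask p c) + 4 * Q /2⌋) (phase-double h<2 7≤q) ⟨
    ⌊ (r ⊕ mask (phase Q) c) + 4 * Q /2⌋                ≡⟨ cong ⌊_/2⌋ (mate-large-block c<3 r<4) ⟨
    ⌊ mate c (r + 4 * Q) /2⌋                            ≡⟨ eq ⟩
    mate ⌊ c /2⌋ ⌊ r + 4 * Q /2⌋                        ≡⟨ half-mate r<4 ⟩
    ((⌊ r /2⌋ + 2 * h) ⊕ mask (phase q) ⌊ c /2⌋) + 4 * q ∎))
    where open ≡-Reasoning

  large-forced : ∀ {r s} → r < 4 → s < 4 →
                 s + 4 * Q < mate c (r + 4 * Q) → r + 4 * Q < mate c (s + 4 * Q) →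
                 (∃ λ c′ → c′ < c × s + 4 * Q ≡ mate c′ (r + 4 * Q)) ⊎
                 ⌊ s + 4 * Q /2⌋ ≡ mate ⌊ c /2⌋ ⌊ r + 4 * Q /2⌋
  large-forced {r} {s} r<4 s<4 s< r< =
    Sum.map moved halved (block-forced (phase q) c<3 h<2 r<4 s<4 (local s< r<4) (local r< s<4))
    where
    open ≡-Reasoning
    local : ∀ {r s} → s + 4 * Q < mate c (r + 4 * Q) → r < 4 → s < r ⊕ mask (phase q ⁻¹) c
    local {r} {s} s< r<4 = subst (λ p → s < r ⊕ mask p c) (phase-double h<2 7≤q)
      (+-cancelʳ-< (4 * Q) s _ (subst (s + 4 * Q <_) (mate-large-block c<3 r<4) s<))
    moved : (∃ λ c′ → c′ < c × s ≡ r ⊕ mask (phase q ⁻¹) c′) →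
            ∃ λ c′ → c′ < c × s + 4 * Q ≡ mate c′ (r + 4 * Q)
    moved (c′ , c′<c , eq) = c′ , c′<c , (begin
      s + 4 * Q                               ≡⟨ cong (_+ 4 * Q) eq ⟩
      (r ⊕ mask (phase q ⁻¹) c′) + 4 * Q      ≡⟨ cong (λ p → (r ⊕ mask p c′) + 4 * Q) (phase-double h<2 7≤q) ⟨
      (r ⊕ mask (phase Q) c′) + 4 * Q         ≡⟨ mate-large-block (<-trans c′<c c<3) r<4 ⟨
      mate c′ (r + 4 * Q)                     ∎)
    halved : ⌊ s /2⌋ + 2 * h ≡ (⌊ r /2⌋ + 2 * h) ⊕ mask (phase q) ⌊ c /2⌋ →
             ⌊ s + 4 * Q /2⌋ ≡ mate ⌊ c /2⌋ ⌊ r + 4 * Q /2⌋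
    halved eq = trans (⌊block/2⌋ s h q) (trans (cong (_+ 4 * q) eq) (sym (half-mate r<4)))

  -- The mate stays in block `Q`, so nothing below it lies in a later block. Used in both
  -- directions, this puts two numbers below each other's mates into one block.
  large-block-≥ : ∀ {r} → r < 4 → ∀ s m → s + 4 * m < mate c (r + 4 * Q) → m ≤ Q
  large-block-≥ {r} r<4 s m lt = block-≤ {s} (block-bounded (phase Q) c<3 r<4)
    (subst (s + 4 * m <_) (mate-large-block c<3 r<4) lt)

-- The four facts for all numbers

involutive : ∀ {c} → c < 3 → ∀ {a} → Size a → mate c (mate c a) ≡ a
involutive c<3 (small a<56)          = small-involutive c<3 a<56
involutive c<3 (large r<4 h<2 7≤q)   = large-involutive c<3 h<2 7≤q r<4

disjoint : ∀ {c} → c < 3 → ∀ {c′} → c′ < c → ∀ {a} → Size a → mate c a ≢ mate c′ a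
disjoint c<3 c′<c (small a<56)         = small-disjoint c<3 c′<c a<56
disjoint c<3 c′<c (large r<4 h<2 7≤q)  = large-disjoint c<3 h<2 7≤q r<4 c′<c

quiet : ∀ {c} → c < 3 → ∀ {a} → Size a → 0 < a + c → ⌊ mate c a /2⌋ ≢ mate ⌊ c /2⌋ ⌊ a /2⌋
quiet c<3 (small a<56)        0<a+c = small-quiet c<3 a<56 0<a+c
quiet c<3 (large r<4 h<2 7≤q) _     = large-quiet c<3 h<2 7≤q r<4

forced : ∀ {c} → c < 3 → ∀ {a b} → Size a → Size b → b < mate c a → a < mate c b →
         (∃ λ c′ → c′ < c × b ≡ mate c′ a) ⊎ ⌊ b /2⌋ ≡ mate ⌊ c /2⌋ ⌊ a /2⌋
forced c<3 (small a<56) (small b<56) b< a< = small-forced c<3 a<56 b<56 b< a<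
forced c<3 (small a<56) (large {r} {h} _ _ 7≤q) b< _ =
  contradiction (<-trans b< (small-bounded c<3 a<56)) (≤⇒≯ (56≤block r h 7≤q))
forced c<3 (large {r} {h} _ _ 7≤q) (small b<56) _ a< =
  contradiction (<-trans a< (small-bounded c<3 b<56)) (≤⇒≯ (56≤block r h 7≤q))
forced {c} c<3 (large {r} {h} {q} r<4 h<2 7≤q) (large {s} s<4 h′<2 7≤q′) b< a< =
  sameBlock (≤-antisym (large-block-≥ c<3 h<2 7≤q r<4 s _ b<)
                       (large-block-≥ c<3 h′<2 7≤q′ s<4 r _ a<)) b< a<
  where
  -- The second block index is generalised to a variable `m` so that the equality of blocks can be
  -- matched with `refl`.
  sameBlock : ∀ {m} → m ≡ h + 2 * q → s + 4 * m < mate c (r + 4 * (h + 2 * q)) →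
              r + 4 * (h + 2 * q) < mate c (s + 4 * m) →
              (∃ λ c′ → c′ < c × s + 4 * m ≡ mate c′ (r + 4 * (h + 2 * q))) ⊎
              ⌊ s + 4 * m /2⌋ ≡ mate ⌊ c /2⌋ ⌊ r + 4 * (h + 2 * q) /2⌋
  sameBlock refl = large-forced c<3 h<2 7≤q r<4 s<4

-- Strategies by induction on the number of coins

exclusive : ∀ {p} → 𝒫 p → ¬ 𝒩 p
exclusive (answer f) (move m p) = exclusive p (f m)

-- Both halves construct strategies: the induction needs an actual `𝒩` for every move out of a
-- 𝒫-position, not merely the absence of a `𝒫`.
Outcome : ℕ → ℕ → ℕ → Set
Outcome a b c = (b ≡ mate c a → 𝒫 (a ∷ b ∷ c ∷ [])) × (b ≢ mate c a → 𝒩 (a ∷ b ∷ c ∷ []))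

halving-decreases : ∀ {a b c} → Any (0 <_) (a ∷ b ∷ c ∷ []) →
                    ⌊ a /2⌋ + ⌊ b /2⌋ + ⌊ c /2⌋ < a + b + c
halving-decreases {suc a} {b} {c} (here _) =
  +-mono-<-≤ (+-mono-<-≤ (⌊n/2⌋<n a) (⌊n/2⌋≤n b)) (⌊n/2⌋≤n c)
halving-decreases {a} {suc b} {c} (there (here _)) =
  +-mono-<-≤ (+-mono-≤-< (⌊n/2⌋≤n a) (⌊n/2⌋<n b)) (⌊n/2⌋≤n c)
halving-decreases {a} {b} {suc c} (there (there (here _))) =
  +-mono-≤-< (+-mono-≤ (⌊n/2⌋≤n a) (⌊n/2⌋≤n b)) (⌊n/2⌋<n c)

-- All `c < 3` are treated in one induction, because halving and moves in the third pile change `c`.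
outcome : ∀ {c} → c < 3 → ∀ a b → Acc _<_ (a + b + c) → Outcome a b c
outcome {c} c<3 a b (acc rec) = win , lose
  where
  fewer₁ : ∀ {a′} → a′ < a → Outcome a′ b c
  fewer₁ lt = outcome c<3 _ b (rec (+-monoˡ-< c (+-monoˡ-< b lt)))

  fewer₂ : ∀ {b′} → b′ < b → Outcome a b′ c
  fewer₂ lt = outcome c<3 a _ (rec (+-monoˡ-< c (+-monoʳ-< a lt)))

  fewer₃ : ∀ {c′} → c′ < c → Outcome a b c′
  fewer₃ lt = outcome (<-trans lt c<3) a b (rec (+-monoʳ-< (a + b) lt))

  halved : Any (0 <_) (a ∷ b ∷ c ∷ []) → Outcome ⌊ a /2⌋ ⌊ b /2⌋ ⌊ c /2⌋
  halved pos = outcome (m<n⇒m<1+n (halved<2 c<3)) _ _ (rec (halving-decreases pos))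

  -- If a = c = 0, then `b` is `mate 0 0`, which is 0, and there is nothing to halve.
  nonempty : ∀ {a b c} → b ≡ mate c a → Any (0 <_) (a ∷ b ∷ c ∷ []) → 0 < a + c
  nonempty {suc a}                _    _ = s≤s z≤n
  nonempty {zero} {_}    {suc c}  _    _ = s≤s z≤n
  nonempty {zero} {zero} {zero}   refl (here ())
  nonempty {zero} {zero} {zero}   refl (there (here ()))
  nonempty {zero} {zero} {zero}   refl (there (there (here ())))

  invol : ∀ x → mate c (mate c x) ≡ x
  invol x = involutive c<3 (size x)

  win : b ≡ mate c a → 𝒫 (a ∷ b ∷ c ∷ [])
  win eq = answer λ where
    -- An involution is injective, so `a′` and `a` cannot both have mate `b`.
    (take (here a′<a)) → proj₂ (fewer₁ a′<a) λ eq′ →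
      <⇒≢ a′<a (trans (sym (invol _))
        (trans (cong (mate c) (trans (sym eq′) eq)) (invol a)))
    (take (there (here b′<b))) → proj₂ (fewer₂ b′<b) λ eq′ → <⇒≢ b′<b (trans eq′ (sym eq))
    (take (there (there (here c′<c)))) → proj₂ (fewer₃ c′<c) λ eq′ →
      disjoint c<3 c′<c (size a) (trans (sym eq) eq′)
    (halve pos) → proj₂ (halved pos) λ eq′ →
      quiet c<3 (size a) (nonempty eq pos) (trans (cong ⌊_/2⌋ (sym eq)) eq′)

  nonzero : ∀ {a b c} → b < mate c a → Any (0 <_) (a ∷ b ∷ c ∷ [])
  nonzero {suc a}                 _ = here (s≤s z≤n)
  nonzero {zero} {suc b}          _ = there (here (s≤s z≤n))
  nonzero {zero} {zero} {suc c}   _ = there (there (here (s≤s z≤n)))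
  nonzero {zero} {zero} {zero} ()

  lose : b ≢ mate c a → 𝒩 (a ∷ b ∷ c ∷ [])
  lose neq with <-cmp b (mate c a) | <-cmp a (mate c b)
  ... | tri≈ _ eq _ | _            = contradiction eq neq
  ... | tri> _ _ gt | _            = move (take (there (here gt))) (proj₁ (fewer₂ gt) refl)
  ... | tri< _ _ _  | tri≈ _ eq _  = contradiction (trans (sym (invol b)) (cong (mate c) (sym eq))) neq
  ... | tri< _ _ _  | tri> _ _ gt  = move (take (here gt)) (proj₁ (fewer₁ gt) (sym (invol b)))
  ... | tri< b< _ _ | tri< a< _ _  = Sum.[ reduce , settle ] (forced c<3 (size a) (size b) b< a<)
    where
    reduce : (∃ λ c′ → c′ < c × b ≡ mate c′ a) → 𝒩 (a ∷ b ∷ c ∷ [])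
    reduce (c′ , c′<c , eq) = move (take (there (there (here c′<c)))) (proj₁ (fewer₃ c′<c) eq)
    settle : ⌊ b /2⌋ ≡ mate ⌊ c /2⌋ ⌊ a /2⌋ → 𝒩 (a ∷ b ∷ c ∷ [])
    settle eq = move (halve pos) (proj₁ (halved pos) eq)
      where
      pos : Any (0 <_) (a ∷ b ∷ c ∷ [])
      pos = nonzero {a} {b} {c} b<

𝒫⇔mate : ∀ {c} → c < 3 → ∀ a b → 𝒫 (a ∷ b ∷ c ∷ []) ⇔ b ≡ mate c a
𝒫⇔mate {c} c<3 a b = mk⇔
  (λ p → decidable-stable (b ≟ mate c a) λ neq → exclusive p (proj₂ result neq))
  (proj₁ result)
  where result = outcome c<3 a b (<-wellFounded (a + b + c))

-- Identification of `φ₂` with `mate 2`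

quotient-log : ∀ k {a} → 7 * 2 ^ k ≤ a → a < 7 * 2 ^ suc k → ⌊log₂ (a ℕ./ 7) ⌋ ≡ k
quotient-log k {a} lo hi = ⌊log₂⌋-unique k
  (subst (_≤ a ℕ./ 7) (trans (cong (ℕ._/ 7) (*-comm 7 (2 ^ k))) (ℕ.m*n/n≡m (2 ^ k) 7)) (ℕ./-monoˡ-≤ 7 lo))
  (ℕ.m<n*o⇒m/o<n (subst (a <_) (*-comm 7 (2 ^ suc k)) hi))

parity-double : ∀ n → parity (2 * n) ≡ 0ℙ
parity-double n = *-homo-* 2 n

-- For c = 2 the mask is 0 in even phase and 2 in odd phase; each clause beyond the table determines
-- the logarithm, hence the phase.
value≡mate : ∀ {x} (cl : Clause x) → value cl ≡ mate 2 x
value≡mate {x} (small x<30) with x <? 30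
... | yes _    = refl
... | no  x≮30 = contradiction x<30 x≮30
value≡mate {x} (middle 30≤x x<56) = begin
  x                        ≡⟨ ⊕-identityʳ x ⟨
  -- The interval lies between 28 = 7 * 2 ^ 2 and 56 = 7 * 2 ^ 3, so the logarithm is 2.
  x ⊕ 0                    ≡⟨ cong (λ k → x ⊕ mask (parity k) 2) (quotient-log 2 (≤-trans (m≤m+n 28 2) 30≤x) x<56) ⟨
  x ⊕ mask (phase x) 2     ≡⟨ mate-large 2 30≤x ⟨
  mate 2 x                 ∎
  where open ≡-Reasoning
value≡mate {x} (fixed n 2≤n lo hi) = begin
  x                          ≡⟨ ⊕-identityʳ x ⟨
  x ⊕ 0                      ≡⟨ cong (λ p → x ⊕ mask p 2) (parity-double n) ⟨
  x ⊕ mask (parity (2 * n)) 2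
                             ≡⟨ cong (λ k → x ⊕ mask (parity k) 2)
                                (quotient-log (2 * n) lo (subst (λ k → x < 7 * 2 ^ k) (+-comm (2 * n) 1) hi)) ⟨
  x ⊕ mask (phase x) 2       ≡⟨ mate-large 2 (≤-trans (m≤m+n 30 82) (≤-trans
                                  (*-monoʳ-≤ 7 (^-monoʳ-≤ 2 (*-monoʳ-≤ 2 2≤n))) lo)) ⟨
  mate 2 x                   ∎
  where open ≡-Reasoning
value≡mate {x} (twisted (suc n) 2≤n lo hi) = begin
  x ⊕ 2                      ≡⟨ cong (λ p → x ⊕ mask p 2) odd ⟨
  x ⊕ mask (parity k) 2      ≡⟨ cong (λ k → x ⊕ mask (parity k) 2) (quotient-log k lo hi) ⟨
  x ⊕ mask (phase x) 2       ≡⟨ mate-large 2 (≤-trans (m≤m+n 30 26) (≤-trans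
                                  (*-monoʳ-≤ 7 (^-monoʳ-≤ 2 (∸-monoˡ-≤ 1 (*-monoʳ-≤ 2 2≤n)))) lo)) ⟨
  mate 2 x                   ∎
  where
  open ≡-Reasoning
  -- With `suc n` exposed, `suc k` computes to `2 * suc n`, so `lo` and `hi` bracket `x` by
  -- consecutive powers.
  k = 2 * suc n ∸ 1
  odd : parity k ≡ 1ℙ
  odd = trans (sym (suc-homo-⁻¹ k)) (cong _⁻¹ (parity-double (suc n)))

-- The closed formula

-- Both sides have period two in `k`, with values 0 and 2.
1+[-1]^[k+1] : ∀ k → + 1 ℤ.+ -1ℤ ℤ.^ (k + 1) ≡ + mask (parity k) 2
1+[-1]^[k+1] zero          = refl
1+[-1]^[k+1] (suc zero)    = refl
1+[-1]^[k+1] (suc (suc k)) = trans (cong (λ z → + 1 ℤ.+ z) (-1*-1* (-1ℤ ℤ.^ (k + 1)))) (1+[-1]^[k+1] k)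
  where
  -1*-1* : ∀ z → -1ℤ ℤ.* (-1ℤ ℤ.* z) ≡ z
  -1*-1* z = trans (sym (ℤ.*-assoc -1ℤ -1ℤ z)) (ℤ.*-identityˡ z)

⌊log₂ℚ⌋-nat : ∀ a → ⌊log₂ℚ + a / 7 ⌋ ≡ ⌊log₂ (a ℕ./ 7) ⌋
-- The floor unfolds to `+ 1` times the natural quotient; the identity law removes this factor.
⌊log₂ℚ⌋-nat a = cong (λ z → ⌊log₂ ℤ.∣ z ∣ ⌋) (ℤ.*-identityˡ (+ (a ℕ./ 7)))

-- XOR with `a` undoes itself, so `b ≡ a ⊕ d` and `a ⊕ b ≡ d` are interchangeable.
xor-mate : ∀ {a} → 30 ≤ a → ∀ b →
           b ≡ mate 2 a ⇔ + (a ⊕ b) ≡ + 1 ℤ.+ -1ℤ ℤ.^ (⌊log₂ℚ + a / 7 ⌋ + 1)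
xor-mate {a} 30≤a b = mk⇔
  (λ eq → trans (cong +_ (trans (cong (a ⊕_) (trans eq (mate-large 2 30≤a))) (⊕-cancelˡ a d))) (sym rhs))
  (λ eq → trans (sym (⊕-cancelˡ a b))
     (trans (cong (a ⊕_) (ℤ.+-injective (trans eq rhs))) (sym (mate-large 2 30≤a))))
  where
  d = mask (phase a) 2
  rhs : + 1 ℤ.+ -1ℤ ℤ.^ (⌊log₂ℚ + a / 7 ⌋ + 1) ≡ + d
  rhs = trans (cong (λ k → + 1 ℤ.+ -1ℤ ℤ.^ (k + 1)) (⌊log₂ℚ⌋-nat a)) (1+[-1]^[k+1] ⌊log₂ (a ℕ./ 7) ⌋)

theorem19 :
    (∀ (a b : ℕ) → 𝒫 (a ∷ b ∷ 2 ∷ []) ⇔ b ≡ φ₂ a)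
    × (∀ (a b : ℕ) → 30 ≤ a → 30 ≤ b →
        𝒫 (a ∷ b ∷ 2 ∷ []) ⇔ + (a ⊕ b) ≡ + 1 ℤ.+ -1ℤ ℤ.^ (⌊log₂ℚ + a / 7 ⌋ + 1))
theorem19 =
  (λ a b → subst (λ x → 𝒫 (a ∷ b ∷ 2 ∷ []) ⇔ b ≡ x) (sym (value≡mate (cover a))) (𝒫⇔mate ≤-refl a b)) ,
  (λ a b 30≤a _ → xor-mate 30≤a b ⇔-∘ 𝒫⇔mate ≤-refl a b)
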